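{- For every integer $n \geq 6$ with $n \equiv 2 \pmod 4$, the $n$-dimensional simplified shuffle-cube $SSQ_n$ is vertex-pancyclic, i.e. for every vertex $u$ of $SSQ_n$ and every integer $l$ with $3 \leq l \leq |V(SSQ_n)| = 2^{(3n+2)/4}$, there is a cycle of length $l$ in $SSQ_n$ that contains $u$.
   Context: All graphs are finite, simple and undirected. The length of a cycle is its number of edges. Notation for binary strings $u = u_{n-1}u_{n-2}\ldots u_1u_0$: the $4$-prefix is $p_4(u) = u_{n-1}u_{n-2}u_{n-3}u_{n-4}$ and the $(n-4)$-suffix is $s_{n-4}(u) = u_{n-5}\ldots u_1u_0$. The symbol $\oplus$ denotes bitwise addition modulo $2$. Let $V_{00} = \{1111, 0001, 0010, 0011\}$. The simplified shuffle-cube $SSQ_n$ is defined recursively for $n \equiv 2 \pmod 4$, $n \geq 2$; its vertices are certain $n$-bit binary strings. $SSQ_2 = Q_2$ is the $4$-cycle on the strings $00,01,10,11$, two strings being adjacent iff they differ in exactly one bit. For $n > 2$, $SSQ_n$ is obtained from eight copies $SSQ_{n-4}^{i_1i_2i_3i_4}$ of $SSQ_{n-4}$, one for each $i_1i_2i_3i_4$ with $i_1i_2 \in \{00,11\}$ and $i_3,i_4 \in \{0,1\}$; the vertices of $SSQ_{n-4}^{i_1i_2i_3i_4}$ are the strings $u$ with $p_4(u) = i_1i_2i_3i_4$ and $s_{n-4}(u)\in V(SSQ_{n-4})$, and two vertices of the same copy are adjacent iff their $(n-4)$-suffixes are adjacent in $SSQ_{n-4}$. Two vertices $u,v$ in different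 copies are adjacent in $SSQ_n$ iff $s_{n-4}(u) = s_{n-4}(v)$ and $p_4(u) \oplus p_4(v) \in V_{00}$. Thus $SSQ_n$ has $2^{(3n+2)/4}$ vertices. -}

module Defs where

open import Data.Bool.Base using (Bool; true; false; _xor_)
open import Data.Bool.Properties using (xor-comm)
open import Data.Empty using (⊥)
open import Data.Fin.Base using (Fin)
open import Data.Fin.Patterns using (0F; 1F; 2F; 3F; 4F; 5F; 6F; 7F)
open import Data.Fin.Properties using (*↔×)
open import Data.List.Base using (List; []; _∷_; _∷ʳ_; length)
open import Data.List.Membership.Propositional using (_∈_)
open import Data.List.Relation.Unary.Any using (here; there)
open import Data.List.Relation.Unary.Linked using (Linked)
open import Data.List.Relation.Unary.Unique.Propositional using (Unique)
open import Data.Nat.Base using (ℕ; suc; _+_; _*_; _≤_)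
open import Data.Product using (Σ; Σ-syntax; ∃!; _×_; _,_)
open import Data.Product.Function.NonDependent.Propositional using (_×-↔_)
open import Data.Sum.Base using (_⊎_; inj₁; inj₂)
open import Data.Unit.Base using (⊤; tt)
open import Data.Vec.Base using (Vec; []; _∷_; lookup; take; drop; zipWith)
open import Data.Vec.Properties using (zipWith-comm)
open import Function.Bundles using (_↔_; mk↔ₛ′)
open import Function.Properties.Inverse using (↔-sym; ↔-trans)
open import Level using (0ℓ)
open import Relation.Binary.Core using (Rel)
open import Relation.Binary.Definitions using (Symmetric; Irreflexive)
open import Relation.Binary.PropositionalEquality
  using (_≡_; _≢_; refl; sym; subst; ≢-sym)

record Graph : Set₁ where
  infix 4 _~_
  field
    Vertex   : Set
    _~_      : Rel Vertex 0ℓ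
    ~-sym    : Symmetric _~_
    ~-irrefl : Irreflexive _≡_ _~_
    order    : ℕ
    finite   : Vertex ↔ Fin order

-- The cycle start, v₁, …, vₖ, start, where rest = v₁ ∷ … ∷ vₖ ∷ [].
record Cycle (G : Graph) : Set where
  open Graph G
  field
    start : Vertex
    rest  : List Vertex

  vertices : List Vertex
  vertices = start ∷ rest

  field
    distinct : Unique vertices
    closed   : Linked _~_ (vertices ∷ʳ start)
    long     : 3 ≤ length vertices

  -- The number of edges, which equals the number of vertices.
  cycleLength : ℕ
  cycleLength = length vertices

VertexPancyclic : Graph → Set
VertexPancyclic G =
  ∀ (u : Vertex) (l : ℕ) → 3 ≤ l → l ≤ order →
  Σ[ c ∈ Cycle G ] (Cycle.cycleLength c ≡ l × u ∈ Cycle.vertices c)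
  where open Graph G

-- The string uₙ₋₁ … u₁ u₀ is the vector uₙ₋₁ ∷ … ∷ u₁ ∷ u₀ ∷ [], leading bit
-- first; 0 is false and 1 is true.
BitString : ℕ → Set
BitString = Vec Bool

infixl 6 _⊕_
_⊕_ : ∀ {n} → BitString n → BitString n → BitString n
_⊕_ = zipWith _xor_

p₄ : ∀ {n} → BitString (4 + n) → BitString 4
p₄ = take 4

suffix : ∀ {n} → BitString (4 + n) → BitString n
suffix = drop 4

pattern 4+_ n = suc (suc (suc (suc n)))

pattern O = false
pattern I = true

V₀₀ : List (BitString 4)
V₀₀ = (I ∷ I ∷ I ∷ I ∷ [])
    ∷ (O ∷ O ∷ O ∷ I ∷ [])
    ∷ (O ∷ O ∷ I ∷ O ∷ [])
    ∷ (O ∷ O ∷ I ∷ I ∷ [])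
    ∷ []

IsCopyIndex : BitString 4 → Set
IsCopyIndex p = take 2 p ∈ (O ∷ O ∷ []) ∷ (I ∷ I ∷ []) ∷ []

-- For n ≢ 2 (mod 4), where the simplified shuffle-cube is not defined, this
-- gives the empty graph.
IsVertex : ∀ n → BitString n → Set
IsVertex 0 u = ⊥
IsVertex 1 u = ⊥
IsVertex 2 u = ⊤
IsVertex 3 u = ⊥
IsVertex (4+ n) u = IsCopyIndex (p₄ u) × IsVertex n (suffix u)

Adjacent : ∀ n → Rel (BitString n) 0ℓ
Adjacent 0 u v = ⊥
Adjacent 1 u v = ⊥
Adjacent 2 u v = ∃! _≡_ λ i → lookup u i ≢ lookup v i
Adjacent 3 u v = ⊥
Adjacent (4+ n) u v =
    (p₄ u ≡ p₄ v × Adjacent n (suffix u) (suffix v))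
  ⊎ (p₄ u ≢ p₄ v × suffix u ≡ suffix v × p₄ u ⊕ p₄ v ∈ V₀₀)

Adjacent-sym : ∀ n → Symmetric (Adjacent n)
Adjacent-sym 2 (i , d , unique) = i , ≢-sym d , λ e → unique (≢-sym e)
Adjacent-sym (4+ n) (inj₁ (p≡q , s~t)) =
  inj₁ (sym p≡q , Adjacent-sym n s~t)
Adjacent-sym (4+ n) {u} {v} (inj₂ (p≢q , s≡t , d)) =
  inj₂ (≢-sym p≢q , sym s≡t ,
        subst (_∈ V₀₀) (zipWith-comm xor-comm (p₄ u) (p₄ v)) d)

Adjacent-irrefl : ∀ n → Irreflexive _≡_ (Adjacent n)
Adjacent-irrefl 2 refl (_ , d , _) = d refl
Adjacent-irrefl (4+ n) refl (inj₁ (_ , s~s)) =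
  Adjacent-irrefl n refl s~s
Adjacent-irrefl (4+ n) refl (inj₂ (p≢p , _)) = p≢p refl

SSQ-Vertex : ℕ → Set
SSQ-Vertex n = Σ (BitString n) (IsVertex n)

SSQ-order : ℕ → ℕ
SSQ-order 0 = 0
SSQ-order 1 = 0
SSQ-order 2 = 4
SSQ-order 3 = 0
SSQ-order (4+ n) = 8 * SSQ-order n

private
  base↔ : SSQ-Vertex 2 ↔ Fin 4
  base↔ = mk↔ₛ′ to from
    (λ { 0F → refl ; 1F → refl ; 2F → refl ; 3F → refl })
    (λ { (O ∷ O ∷ [] , tt) → refl ; (O ∷ I ∷ [] , tt) → refl
       ; (I ∷ O ∷ [] , tt) → refl ; (I ∷ I ∷ [] , tt) → refl })
    where
    to : SSQ-Vertex 2 → Fin 4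
    to (O ∷ O ∷ [] , _) = 0F
    to (O ∷ I ∷ [] , _) = 1F
    to (I ∷ O ∷ [] , _) = 2F
    to (I ∷ I ∷ [] , _) = 3F

    from : Fin 4 → SSQ-Vertex 2
    from 0F = O ∷ O ∷ [] , tt
    from 1F = O ∷ I ∷ [] , tt
    from 2F = I ∷ O ∷ [] , tt
    from 3F = I ∷ I ∷ [] , tt

  copy↔ : Σ (BitString 4) IsCopyIndex ↔ Fin 8
  copy↔ = mk↔ₛ′ to from
    (λ { 0F → refl ; 1F → refl ; 2F → refl ; 3F → refl
       ; 4F → refl ; 5F → refl ; 6F → refl ; 7F → refl })
    (λ { (.O ∷ .O ∷ O ∷ O ∷ [] , here refl) → refl
       ; (.O ∷ .O ∷ O ∷ I ∷ [] , here refl) → refl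
       ; (.O ∷ .O ∷ I ∷ O ∷ [] , here refl) → refl
       ; (.O ∷ .O ∷ I ∷ I ∷ [] , here refl) → refl
       ; (.I ∷ .I ∷ O ∷ O ∷ [] , there (here refl)) → refl
       ; (.I ∷ .I ∷ O ∷ I ∷ [] , there (here refl)) → refl
       ; (.I ∷ .I ∷ I ∷ O ∷ [] , there (here refl)) → refl
       ; (.I ∷ .I ∷ I ∷ I ∷ [] , there (here refl)) → refl })
    where
    to : Σ (BitString 4) IsCopyIndex → Fin 8
    to (_ ∷ _ ∷ O ∷ O ∷ [] , here _) = 0F
    to (_ ∷ _ ∷ O ∷ I ∷ [] , here _) = 1F
    to (_ ∷ _ ∷ I ∷ O ∷ [] , here _) = 2F
    to (_ ∷ _ ∷ I ∷ I ∷ [] , here _) = 3F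
    to (_ ∷ _ ∷ O ∷ O ∷ [] , there _) = 4F
    to (_ ∷ _ ∷ O ∷ I ∷ [] , there _) = 5F
    to (_ ∷ _ ∷ I ∷ O ∷ [] , there _) = 6F
    to (_ ∷ _ ∷ I ∷ I ∷ [] , there _) = 7F

    from : Fin 8 → Σ (BitString 4) IsCopyIndex
    from 0F = O ∷ O ∷ O ∷ O ∷ [] , here refl
    from 1F = O ∷ O ∷ O ∷ I ∷ [] , here refl
    from 2F = O ∷ O ∷ I ∷ O ∷ [] , here refl
    from 3F = O ∷ O ∷ I ∷ I ∷ [] , here refl
    from 4F = I ∷ I ∷ O ∷ O ∷ [] , there (here refl)
    from 5F = I ∷ I ∷ O ∷ I ∷ [] , there (here refl)
    from 6F = I ∷ I ∷ I ∷ O ∷ [] , there (here refl)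
    from 7F = I ∷ I ∷ I ∷ I ∷ [] , there (here refl)

  split↔ : ∀ n → SSQ-Vertex (4+ n) ↔
           (Σ (BitString 4) IsCopyIndex × SSQ-Vertex n)
  split↔ n = mk↔ₛ′
    (λ (u , i , v) → (p₄ u , i) , (suffix u , v))
    (λ { ((a ∷ b ∷ c ∷ d ∷ [] , i) , (s , v)) → a ∷ b ∷ c ∷ d ∷ s , i , v })
    (λ { ((_ ∷ _ ∷ _ ∷ _ ∷ [] , _) , _) → refl })
    (λ { (_ ∷ _ ∷ _ ∷ _ ∷ _ , _) → refl })

SSQ-finite : ∀ n → SSQ-Vertex n ↔ Fin (SSQ-order n)
SSQ-finite 0 = mk↔ₛ′ (λ { (_ , ()) }) (λ ()) (λ ()) (λ { (_ , ()) })
SSQ-finite 1 = mk↔ₛ′ (λ { (_ , ()) }) (λ ()) (λ ()) (λ { (_ , ()) })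
SSQ-finite 2 = base↔
SSQ-finite 3 = mk↔ₛ′ (λ { (_ , ()) }) (λ ()) (λ ()) (λ { (_ , ()) })
SSQ-finite (4+ n) =
  ↔-trans (split↔ n) (↔-trans (copy↔ ×-↔ SSQ-finite n) (↔-sym *↔×))

SSQ : ℕ → Graph
SSQ n = record
  { Vertex   = SSQ-Vertex n
  ; _~_      = λ (u , _) (v , _) → Adjacent n u v
  ; ~-sym    = Adjacent-sym n
  ; ~-irrefl = λ { refl → Adjacent-irrefl n refl }
  ; order    = SSQ-order n
  ; finite   = SSQ-finite n
  }

{-# OPTIONS --safe #-}

-- SSQ_{n+4} is the Cartesian product of K₂, K₄ and SSQ_n: the first two prefix
-- bits choose the K₂ coordinate, whose edges are the 1111-edges, and the last
-- two choose the K₄ coordinate.  Sweeping the K₄-fibres along a Hamiltonian path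
-- of SSQ_n gives a Hamiltonian path v₀ v₁ v₂ … of K₄ □ SSQ_n in which v₀ v₁ v₂ is
-- a triangle.  In the product with K₂, the ladders over its initial segments are
-- the cycles of even length; shortcutting one side of a ladder by the chord
-- v₀ v₂ gives the odd lengths.  The full ladder without its last edge is a
-- Hamiltonian path of SSQ_{n+4}, which keeps the induction going.
module Submission where

open import Defs
open import Data.Bool.Base using (Bool; true; false; not; _xor_)
open import Data.Bool.Properties
  using (xor-same; xor-inverseʳ; not-injective; not-¬)
open import Data.Fin.Patterns using (0F; 1F)
open import Data.List.Base using (List; []; _∷_; _∷ʳ_; length; take)
open import Data.List.Membership.Propositional using (_∈_)
open import Data.List.Properties using (length-++-comm; length-take)
open import Data.List.Relation.Unary.All as All using (All; []; _∷_)
import Data.List.Relation.Unary.All.Properties as All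
open import Data.List.Relation.Unary.AllPairs using ([]; _∷_)
import Data.List.Relation.Unary.AllPairs.Properties as AllPairs
open import Data.List.Relation.Unary.Any using (here; there)
open import Data.List.Relation.Unary.Linked using (Linked; []; [-]; _∷_)
open import Data.List.Relation.Unary.Unique.Propositional using (Unique)
open import Data.Nat
  using (ℕ; zero; suc; _+_; _*_; _^_; _/_; _%_; _≤_; s≤s; z≤n)
open import Data.Nat.DivMod using (_divMod_; result; m*n/n≡m; m≡m%n+[m/n]*n)
open import Data.Nat.Properties
  using (*-assoc; *-comm; *-cancelʳ-≤; *-cancelʳ-<; ≤-pred;
         m≤n⇒m⊓n≡m)
open import Data.Nat.Tactic.RingSolver using (solve-∀)
open import Data.Product using (Σ-syntax; _×_; _,_; proj₁; proj₂)
open import Data.Sum.Base using (_⊎_; inj₁; inj₂)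
open import Data.Unit.Base using (tt)
open import Data.Vec.Base as Vec using ([]; _∷_)
open import Function.Base using (_∘_)
open import Level using (0ℓ)
open import Relation.Binary.Core using (Rel)
open import Relation.Binary.PropositionalEquality
  using (_≡_; _≢_; refl; sym; trans; cong; cong₂; subst; ≢-sym; module ≡-Reasoning)
open import Relation.Nullary using (contradiction)

-- Paths as lists: appending and truncating.

module _ {A : Set} where

  Unique-∷ʳ⁺ : ∀ {xs : List A} {y} → Unique xs → All (_≢ y) xs → Unique (xs ∷ʳ y)
  Unique-∷ʳ⁺ u xs≢y = AllPairs.++⁺ u ([] ∷ []) (All.map (_∷ []) xs≢y)

  length-∷ʳ : ∀ (xs : List A) x → length (xs ∷ʳ x) ≡ suc (length xs)
  length-∷ʳ xs x = length-++-comm xs (x ∷ [])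

  module _ {_~_ : Rel A 0ℓ} where

    -- Writing the path as `xs ∷ʳ y` exposes its last vertex, to which the new edge attaches.
    Linked-∷ʳ⁺ : ∀ xs {y z} → Linked _~_ (xs ∷ʳ y) → y ~ z →
                 Linked _~_ (xs ∷ʳ y ∷ʳ z)
    Linked-∷ʳ⁺ []           [-]     y~z = y~z ∷ [-]
    Linked-∷ʳ⁺ (_ ∷ [])     (e ∷ l) y~z = e ∷ Linked-∷ʳ⁺ [] l y~z
    Linked-∷ʳ⁺ (_ ∷ x ∷ xs) (e ∷ l) y~z = e ∷ Linked-∷ʳ⁺ (x ∷ xs) l y~z

    Linked-take⁺ : ∀ {xs} n → Linked _~_ xs → Linked _~_ (take n xs)
    Linked-take⁺ 0             l       = []
    Linked-take⁺ (suc n)       []      = []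
    Linked-take⁺ (suc 0)       [-]     = [-]
    Linked-take⁺ (suc (suc n)) [-]     = [-]
    Linked-take⁺ (suc 0)       (e ∷ l) = [-]
    Linked-take⁺ (suc (suc n)) (e ∷ l) = e ∷ Linked-take⁺ (suc n) l

-- Sweeping the complete fibres of a product.

module _ {A B : Set} where

  -- The Cartesian product of the complete graph on A with a graph on B.
  K□ : Rel B 0ℓ → Rel (A × B) 0ℓ
  K□ _~_ (a , s) (b , t) = (a ≢ b × s ≡ t) ⊎ (a ≡ b × s ~ t)

  -- The order of the fibre is reversed each time, so a fibre ends at the `A`-coordinate where the
  -- next one begins, and an edge on `B` joins them. Inside a fibre any order of distinct entries is
  -- a path.
  sweep : A → A → A → A → List B → List (A × B)
  sweep a b c d []       = []
  sweep a b c d (s ∷ ss) =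
    (a , s) ∷ (b , s) ∷ (c , s) ∷ (d , s) ∷ sweep d c b a ss

  length-sweep : ∀ a b c d ss → length (sweep a b c d ss) ≡ length ss * 4
  length-sweep a b c d []       = refl
  length-sweep a b c d (_ ∷ ss) = cong (4 +_) (length-sweep d c b a ss)

  sweep-All : ∀ {P : B → Set} {a b c d ss} → All P ss →
              All (P ∘ proj₂) (sweep a b c d ss)
  sweep-All []       = []
  sweep-All (p ∷ ps) = p ∷ p ∷ p ∷ p ∷ sweep-All ps

  reverse-distinct : ∀ {a b c d : A} → Unique (a ∷ b ∷ c ∷ d ∷ []) →
                     Unique (d ∷ c ∷ b ∷ a ∷ [])
  reverse-distinct ((ab ∷ ac ∷ ad ∷ []) ∷ (bc ∷ bd ∷ []) ∷ (cd ∷ []) ∷ [] ∷ []) =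
    (≢-sym cd ∷ ≢-sym bd ∷ ≢-sym ad ∷ []) ∷
    (≢-sym bc ∷ ≢-sym ac ∷ []) ∷ (≢-sym ab ∷ []) ∷ [] ∷ []

  sweep-Unique : ∀ {a b c d ss} → Unique (a ∷ b ∷ c ∷ d ∷ []) → Unique ss →
                 Unique (sweep a b c d ss)
  sweep-Unique _ [] = []
  sweep-Unique
    ds@((ab ∷ ac ∷ ad ∷ []) ∷ (bc ∷ bd ∷ []) ∷ (cd ∷ []) ∷ [] ∷ [])
    (s∉ ∷ u) =
      (fst ab ∷ fst ac ∷ fst ad ∷ rest)
    ∷ (fst bc ∷ fst bd ∷ rest)
    ∷ (fst cd ∷ rest)
    ∷ rest
    ∷ sweep-Unique (reverse-distinct ds) u
    where
    fst : ∀ {x y s} → x ≢ y → (x , s) ≢ (y , s)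
    fst x≢y refl = x≢y refl

    -- Entries of later fibres already differ in the second coordinate.
    rest : ∀ {x} → All ((x , _) ≢_) _
    rest = All.map (λ s≢t e → s≢t (cong proj₂ e)) (sweep-All s∉)

  sweep-Linked : ∀ {_~_ : Rel B 0ℓ} {a b c d ss} →
                 Unique (a ∷ b ∷ c ∷ d ∷ []) → Linked _~_ ss →
                 Linked (K□ _~_) (sweep a b c d ss)
  sweep-Linked _ [] = []
  sweep-Linked ((ab ∷ _) ∷ (bc ∷ _) ∷ (cd ∷ _) ∷ _) [-] =
    inj₁ (ab , refl) ∷ inj₁ (bc , refl) ∷ inj₁ (cd , refl) ∷ [-]
  sweep-Linked ds@((ab ∷ _) ∷ (bc ∷ _) ∷ (cd ∷ _) ∷ _) (e ∷ l) =
    inj₁ (ab , refl) ∷ inj₁ (bc , refl) ∷ inj₁ (cd , refl) ∷ inj₂ (refl , e) ∷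
    sweep-Linked (reverse-distinct ds) l

-- Cycles of all lengths in a ladder.

CycleThrough : (G : Graph) → Graph.Vertex G → ℕ → Set
CycleThrough G u l = Σ[ c ∈ Cycle G ] (Cycle.cycleLength c ≡ l × u ∈ Cycle.vertices c)

module _ (G : Graph) where

  open Graph G

  -- The maps `f` and `g` are the two rails: disjoint copies of `H` inside `G`, matched by rungs.
  module Ladder
    {H : Set} {_∼_ : Rel H 0ℓ} (f g : H → Vertex)
    (f-adj : ∀ v w → v ∼ w → f v ~ f w) (g-adj : ∀ v w → v ∼ w → g v ~ g w)
    (f-inj : ∀ {v w} → f v ≡ f w → v ≡ w) (g-inj : ∀ {v w} → g v ≡ g w → v ≡ w)
    (rung : ∀ v → f v ~ g v) (f≢g : ∀ {v w} → f v ≢ g w)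
    where

    -- Out along `f` and back along `g`: the list ends at `g v`, opposite its first vertex `f v`, so
    -- one more rung closes it.
    ladder : List H → List Vertex
    ladder []       = []
    ladder (v ∷ vs) = f v ∷ ladder vs ∷ʳ g v

    length-ladder : ∀ vs → length (ladder vs) ≡ length vs * 2
    length-ladder []       = refl
    length-ladder (v ∷ vs) =
      cong suc (trans (length-∷ʳ (ladder vs) (g v)) (cong suc (length-ladder vs)))

    ladder-All : ∀ {P : Vertex → Set} {vs} → All (P ∘ f) vs → All (P ∘ g) vs →
                 All P (ladder vs)
    ladder-All []       []       = []
    ladder-All (p ∷ ps) (q ∷ qs) = p ∷ All.∷ʳ⁺ (ladder-All ps qs) q

    f∉ladder : ∀ {v vs} → All (v ≢_) vs → All (f v ≢_) (ladder vs)
    f∉ladder v∉ = ladder-All (All.map (_∘ f-inj) v∉) (All.map (λ _ → f≢g) v∉)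

    ladder∌g : ∀ {v vs} → All (v ≢_) vs → All (_≢ g v) (ladder vs)
    ladder∌g v∉ =
      ladder-All (All.map (λ _ → f≢g) v∉) (All.map (λ v≢w → v≢w ∘ sym ∘ g-inj) v∉)

    ladder-Unique : ∀ {vs} → Unique vs → Unique (ladder vs)
    ladder-Unique []       = []
    ladder-Unique (v∉ ∷ u) =
      All.∷ʳ⁺ (f∉ladder v∉) f≢g ∷ Unique-∷ʳ⁺ (ladder-Unique u) (ladder∌g v∉)

    ladder-Linked : ∀ {vs} → Linked _∼_ vs → Linked _~_ (ladder vs)
    ladder-Linked []                     = []
    ladder-Linked {v ∷ []}     [-]       = rung v ∷ [-]
    ladder-Linked {v ∷ w ∷ vs} (v∼w ∷ l) =
      f-adj _ _ v∼w ∷ Linked-∷ʳ⁺ (f w ∷ ladder vs) (ladder-Linked l) (~-sym (g-adj _ _ v∼w))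

    close : ∀ {v l} xs → 3 ≤ l → length (f v ∷ xs ∷ʳ g v) ≡ l →
            Linked _~_ (f v ∷ xs ∷ʳ g v) → Unique (f v ∷ xs ∷ʳ g v) →
            CycleThrough G (f v) l
    close {v} xs 3≤l len link uniq = record
      { start    = f v
      ; rest     = xs ∷ʳ g v
      ; distinct = uniq
      ; closed   = Linked-∷ʳ⁺ (f v ∷ xs) link (~-sym (rung v))
      ; long     = subst (3 ≤_) (sym len) 3≤l
      } , len , here refl

    ladder-cycle : ∀ {v w vs} → Linked _∼_ (v ∷ w ∷ vs) → Unique (v ∷ w ∷ vs) →
                   CycleThrough G (f v) (length (v ∷ w ∷ vs) * 2)
    ladder-cycle {v} {w} {vs} link uniq =
      close (ladder (w ∷ vs)) (s≤s (s≤s (s≤s z≤n))) (length-ladder (v ∷ w ∷ vs))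
        (ladder-Linked link) (ladder-Unique uniq)

    -- Returning from `g x` straight to `g v` skips `g w`, so the ladder over `3 + length vs`
    -- vertices loses one vertex and the length becomes odd.
    chord-cycle : ∀ {v w x vs} → v ∼ x → Linked _∼_ (v ∷ w ∷ x ∷ vs) →
                  Unique (v ∷ w ∷ x ∷ vs) →
                  CycleThrough G (f v) (5 + length vs * 2)
    chord-cycle {v} {w} {x} {vs} v∼x (v∼w ∷ w∼x ∷ link)
                ((v≢w ∷ v∉) ∷ w∉ ∷ uniq) =
      close (f w ∷ ladder (x ∷ vs)) (s≤s (s≤s (s≤s z≤n)))
        (cong (2 +_) (trans (length-∷ʳ (ladder (x ∷ vs)) (g v))
                            (cong suc (length-ladder (x ∷ vs)))))
        (f-adj _ _ v∼w ∷ f-adj _ _ w∼x ∷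
         Linked-∷ʳ⁺ (f x ∷ ladder vs) (ladder-Linked link) (~-sym (g-adj _ _ v∼x)))
        ( (v≢w ∘ f-inj ∷ All.∷ʳ⁺ (f∉ladder v∉) f≢g)
        ∷ All.∷ʳ⁺ (f∉ladder w∉) f≢g
        ∷ Unique-∷ʳ⁺ (ladder-Unique uniq) (ladder∌g v∉))

    -- Chord cycles have length at least 5; length 3 comes from the `f` rail alone.
    triangle : ∀ {v w x} → v ∼ x → Linked _∼_ (v ∷ w ∷ x ∷ []) →
               Unique (v ∷ w ∷ x ∷ []) → CycleThrough G (f v) 3
    triangle {v} {w} {x} v∼x (v∼w ∷ w∼x ∷ [-]) ((vw ∷ vx ∷ []) ∷ (wx ∷ []) ∷ [] ∷ []) =
      record
      { start    = f v
      ; rest     = f w ∷ f x ∷ []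
      ; distinct = (vw ∘ f-inj ∷ vx ∘ f-inj ∷ []) ∷ (wx ∘ f-inj ∷ []) ∷ [] ∷ []
      ; closed   = f-adj _ _ v∼w ∷ f-adj _ _ w∼x ∷ ~-sym (f-adj _ _ v∼x) ∷ [-]
      ; long     = s≤s (s≤s (s≤s z≤n))
      } , refl , here refl

    cycles : ∀ {v w x vs} → v ∼ x → Linked _∼_ (v ∷ w ∷ x ∷ vs) →
             Unique (v ∷ w ∷ x ∷ vs) →
             ∀ l → 3 ≤ l → l ≤ length (v ∷ w ∷ x ∷ vs) * 2 →
             CycleThrough G (f v) l
    cycles {v} {w} {x} {vs} v∼x link uniq (suc (suc (suc m))) (s≤s (s≤s (s≤s z≤n))) l≤
      -- Since `l` is `3 + m`, remainder 0 means odd `l`: 3 for quotient zero, otherwise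
      -- `5 + q * 2`. Remainder 1 gives `(2 + q) * 2`, the ladder over `2 + q` vertices.
      with m divMod 2
    ... | result zero 0F refl =
      triangle v∼x (Linked-take⁺ 3 link) (AllPairs.take⁺ 3 uniq)
    ... | result (suc q) 0F refl =
      subst (λ k → CycleThrough G (f v) (5 + k * 2)) (trans (length-take q vs) (m≤n⇒m⊓n≡m q≤))
        (chord-cycle v∼x (Linked-take⁺ (3 + q) link) (AllPairs.take⁺ (3 + q) uniq))
      where
      q≤ : q ≤ length vs
      -- Read as a strict inequality, `l≤` says `(2 + q) * 2 < (3 + length vs) * 2`, so both sides
      -- can be halved.
      q≤ = ≤-pred (≤-pred (≤-pred (*-cancelʳ-< 2 (2 + q) (3 + length vs) l≤)))
    ... | result q 1F refl =
      subst (λ k → CycleThrough G (f v) (suc k * 2))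
        (trans (length-take (suc q) (w ∷ x ∷ vs)) (m≤n⇒m⊓n≡m q<))
        (ladder-cycle (Linked-take⁺ (2 + q) link) (AllPairs.take⁺ (2 + q) uniq))
      where
      q< : suc q ≤ length (w ∷ x ∷ vs)
      q< = ≤-pred (*-cancelʳ-≤ (2 + q) (3 + length vs) 2 l≤)

-- Distinct vertices, `order` many of them, encode that the path is spanning.
HamiltonianPathFrom : (G : Graph) → Graph.Vertex G → Set
HamiltonianPathFrom G u =
  Σ[ vs ∈ List Vertex ] (Linked _~_ (u ∷ vs) × Unique (u ∷ vs) × length (u ∷ vs) ≡ order)
  where open Graph G

-- From `SSQ n` to `SSQ (4+ n)`.

module Step (n : ℕ) where

  open Graph (SSQ n) using () renaming (Vertex to S; _~_ to _~ₙ_)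
  open Graph (SSQ (4+ n)) using (Vertex; _~_)

  copyIndex : ∀ h c d → IsCopyIndex (h ∷ h ∷ c ∷ d ∷ [])
  copyIndex false _ _ = here refl
  copyIndex true  _ _ = there (here refl)

  node : Bool → (Bool × Bool) × S → Vertex
  node h ((c , d) , (s , v)) = h ∷ h ∷ c ∷ d ∷ s , copyIndex h c d , v

  -- A 1111-edge complements the last two prefix bits as well, so the opposite half is read through
  -- `flip` to make the rungs join equal coordinates.
  flip : (Bool × Bool) × S → (Bool × Bool) × S
  flip ((c , d) , s) = (not c , not d) , s

  half : Vertex → Bool
  half (u , _) = Vec.head u

  coordinates : Vertex → (Bool × Bool) × S
  coordinates (_ ∷ _ ∷ c ∷ d ∷ s , _ , v) = (c , d) , (s , v)

  -- Matching on the membership proof forces the two leading bits to agree and fixes the proof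
  -- itself. Results about `node` can thus be transported to every vertex.
  node-coordinates : ∀ u → u ≡ node (half u) (coordinates u)
  node-coordinates (.O ∷ .O ∷ c ∷ d ∷ s , here refl , v)         = refl
  node-coordinates (.I ∷ .I ∷ c ∷ d ∷ s , there (here refl) , v) = refl

  xor-false : ∀ x y → x xor y ≡ false → x ≡ y
  xor-false false false _ = refl
  xor-false true  true  _ = refl

  -- Besides 1111, `V₀₀` holds exactly the three nonzero strings beginning with 00.
  K₄-edge : ∀ h {c d c′ d′} → (c , d) ≢ (c′ , d′) →
            (h ∷ h ∷ c ∷ d ∷ []) ⊕ (h ∷ h ∷ c′ ∷ d′ ∷ []) ∈ V₀₀
  K₄-edge h {c} {d} {c′} {d′} ne
    rewrite xor-same h with c xor c′ in e | d xor d′ in e′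
  ... | false | false =
    contradiction (cong₂ _,_ (xor-false c c′ e) (xor-false d d′ e′)) ne
  ... | false | true  = there (here refl)
  ... | true  | false = there (there (here refl))
  ... | true  | true  = there (there (there (here refl)))

  node-adj : ∀ h v w → K□ _~ₙ_ v w → node h v ~ node h w
  node-adj h _ _ (inj₁ (ne , refl)) = inj₂ ((λ { refl → ne refl }) , refl , K₄-edge h ne)
  node-adj h _ _ (inj₂ (refl , e))  = inj₁ (refl , e)

  K₂-edge : ∀ h v → node h v ~ node (not h) (flip v)
  K₂-edge h ((c , d) , s) = inj₂ (not-¬ refl ∘ cong Vec.head , refl , 1111∈V₀₀)
    where
    1111∈V₀₀ : (h ∷ h ∷ c ∷ d ∷ []) ⊕ (not h ∷ not h ∷ not c ∷ not d ∷ []) ∈ V₀₀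
    1111∈V₀₀ rewrite xor-inverseʳ h | xor-inverseʳ c | xor-inverseʳ d = here refl

  -- Complementing is injective, and in a complete graph that is enough to preserve adjacency.
  node-flip-adj : ∀ h v w → K□ _~ₙ_ v w → node h (flip v) ~ node h (flip w)
  node-flip-adj h v w (inj₁ (ne , s≡t)) =
    node-adj h (flip v) (flip w) (inj₁ (ne ∘ not²-injective , s≡t))
    where
    not²-injective : ∀ {c d c′ d′} → (not c , not d) ≡ (not c′ , not d′) →
                     (c , d) ≡ (c′ , d′)
    not²-injective e =
      cong₂ _,_ (not-injective (cong proj₁ e)) (not-injective (cong proj₂ e))
  node-flip-adj h v w (inj₂ (refl , e)) =
    node-adj h (flip v) (flip w) (inj₂ (refl , e))

  flip-injective : ∀ {v w} → flip v ≡ flip w → v ≡ w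
  flip-injective e =
    cong₂ _,_ (cong₂ _,_ (not-injective (cong (proj₁ ∘ proj₁) e))
                         (not-injective (cong (proj₂ ∘ proj₁) e)))
              (cong proj₂ e)

  -- The parameter `h` lets the half of the given vertex serve as the `f` rail, where the cycles are
  -- anchored.
  module L (h : Bool) = Ladder (SSQ (4+ n)) (node h) (node (not h) ∘ flip)
    (node-adj h) (node-flip-adj (not h))
    (cong coordinates) (flip-injective ∘ cong coordinates)
    (K₂-edge h) (not-¬ refl ∘ cong half)

  -- Starting at the given pair makes the sweep begin at the prescribed vertex.
  fibre : Bool × Bool → List (Bool × Bool)
  fibre (c , d) = (c , d) ∷ (c , not d) ∷ (not c , not d) ∷ (not c , d) ∷ []

  fibre-Unique : ∀ p → Unique (fibre p)
  fibre-Unique (c , d) =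
      (d≢ ∘ cong proj₂ ∷ c≢ ∘ cong proj₁ ∷ c≢ ∘ cong proj₁ ∷ [])
    ∷ (c≢ ∘ cong proj₁ ∷ c≢ ∘ cong proj₁ ∷ [])
    ∷ (≢-sym d≢ ∘ cong proj₂ ∷ [])
    ∷ [] ∷ []
    where
    c≢ = not-¬ {c} refl
    d≢ = not-¬ {d} refl

  module Half (p : Bool × Bool) {s : S} (path : HamiltonianPathFrom (SSQ n) s) where

    halfPath : List ((Bool × Bool) × S)
    halfPath = let c , d = p in
      sweep (c , d) (c , not d) (not c , not d) (not c , d) (s ∷ proj₁ path)

    halfPath-Linked : Linked (K□ _~ₙ_) halfPath
    halfPath-Linked = sweep-Linked (fibre-Unique p) (proj₁ (proj₂ path))

    halfPath-Unique : Unique halfPath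
    halfPath-Unique =
      sweep-Unique (fibre-Unique p) (proj₁ (proj₂ (proj₂ path)))

    length-halfPath : length halfPath * 2 ≡ SSQ-order (4+ n)
    length-halfPath = begin
      length halfPath * 2
        ≡⟨ cong (_* 2) (length-sweep _ _ _ _ (s ∷ proj₁ path)) ⟩
      length (s ∷ proj₁ path) * 4 * 2
        ≡⟨ cong (λ k → k * 4 * 2) (proj₂ (proj₂ (proj₂ path))) ⟩
      SSQ-order n * 4 * 2
        ≡⟨ *-assoc (SSQ-order n) 4 2 ⟩
      SSQ-order n * 8
        ≡⟨ *-comm (SSQ-order n) 8 ⟩
      8 * SSQ-order n
        ∎
      where open ≡-Reasoning

  hamiltonian : (∀ s → HamiltonianPathFrom (SSQ n) s) →
                ∀ u → HamiltonianPathFrom (SSQ (4+ n)) u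
  hamiltonian paths u =
    subst (HamiltonianPathFrom (SSQ (4+ n))) (sym (node-coordinates u))
      ( _ , ladder-Linked halfPath-Linked , ladder-Unique halfPath-Unique
      , trans (length-ladder halfPath) length-halfPath)
    where
    open L (half u)
    open Half (proj₁ (coordinates u)) (paths (proj₂ (coordinates u)))

  pancyclic : (∀ s → HamiltonianPathFrom (SSQ n) s) → VertexPancyclic (SSQ (4+ n))
  pancyclic paths u l 3≤l l≤ =
    subst (λ v → CycleThrough (SSQ (4+ n)) v l) (sym (node-coordinates u))
      -- The first three vertices of `halfPath` lie in one fibre; the first and third differ in the
      -- bit `c`, which gives the chord.
      (cycles (inj₁ (fibre-chord , refl)) halfPath-Linked halfPath-Unique l 3≤l
              (subst (l ≤_) (sym length-halfPath) l≤))
    where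
    open L (half u)
    open Half (proj₁ (coordinates u)) (paths (proj₂ (coordinates u)))

    fibre-chord : proj₁ (coordinates u) ≢ _
    fibre-chord = not-¬ refl ∘ cong proj₁

-- Base case, induction and the order formula.

Q₂-hamiltonian : ∀ u → HamiltonianPathFrom (SSQ 2) u
Q₂-hamiltonian (a ∷ b ∷ [] , tt) =
    (a ∷ not b ∷ [] , tt) ∷ (not a ∷ not b ∷ [] , tt) ∷ (not a ∷ b ∷ [] , tt) ∷ []
  -- The path flips the second bit, then the first, then the second back.
  , ( (1F , not-¬ refl , λ { {0F} ne → contradiction refl ne ; {1F} _ → refl })
    ∷ (0F , not-¬ refl , λ { {0F} _ → refl ; {1F} ne → contradiction refl ne })
    ∷ (1F , ≢-sym (not-¬ refl) , λ { {0F} ne → contradiction refl ne ; {1F} _ → refl })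
    ∷ [-])
  , ( (b≢ ∘ cong snd ∷ a≢ ∘ cong fst ∷ a≢ ∘ cong fst ∷ [])
    ∷ (a≢ ∘ cong fst ∷ a≢ ∘ cong fst ∷ [])
    ∷ (≢-sym b≢ ∘ cong snd ∷ [])
    ∷ [] ∷ [])
  , refl
  where
  fst snd : SSQ-Vertex 2 → Bool
  fst (u , _) = Vec.lookup u 0F
  snd (u , _) = Vec.lookup u 1F
  a≢ = not-¬ {a} refl
  b≢ = not-¬ {b} refl

-- The induction carries Hamiltonian paths rather than pancyclicity, since the 4-cycle at its base
-- has no triangle.
SSQ-hamiltonian : ∀ k u → HamiltonianPathFrom (SSQ (2 + k * 4)) u
SSQ-hamiltonian zero    = Q₂-hamiltonian
SSQ-hamiltonian (suc k) = Step.hamiltonian (2 + k * 4) (SSQ-hamiltonian k)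

SSQ-order≡ : ∀ k → SSQ-order (2 + k * 4) ≡ 2 ^ (2 + k * 3)
SSQ-order≡ zero    = refl
SSQ-order≡ (suc k) = trans (cong (8 *_) (SSQ-order≡ k)) (lemma (2 ^ (2 + k * 3)))
  where
  lemma : ∀ x → 8 * x ≡ 2 * (2 * (2 * x))
  lemma = solve-∀

-- The numerator is a multiple of 4, so the truncating division is exact.
exponent : ∀ k → (3 * (2 + k * 4) + 2) / 4 ≡ 2 + k * 3
exponent k = trans (cong (_/ 4) (lemma k)) (m*n/n≡m (2 + k * 3) 4)
  where
  lemma : ∀ k → 3 * (2 + k * 4) + 2 ≡ (2 + k * 3) * 4
  lemma = solve-∀

theorem6 : ∀ (n : ℕ) → 6 ≤ n → n % 4 ≡ 2 →
    Graph.order (SSQ n) ≡ 2 ^ ((3 * n + 2) / 4) × VertexPancyclic (SSQ n)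
theorem6 n 6≤n n%4≡2
  with n / 4 | trans (m≡m%n+[m/n]*n n 4) (cong (_+ n / 4 * 4) n%4≡2)
-- Quotient zero would make `n` equal to 2.
... | zero  | refl = contradiction 6≤n λ { (s≤s (s≤s ())) }
... | suc k | refl =
    trans (SSQ-order≡ (suc k)) (cong (2 ^_) (sym (exponent (suc k))))
  , Step.pancyclic (2 + k * 4) (SSQ-hamiltonian k)
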